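{- For an irreducible fraction $\frac{r}{s}$, the polynomial $\mathcal{S}_{\frac{r}{s}}(q)$ is palindromic if and only if $r^2\equiv 1\pmod s$.
   Context: For an integer $c$, $[c]_q=\frac{1-q^c}{1-q}$. Every rational $\alpha>1$ has a unique negative continued fraction expansion $\alpha=c_1-\cfrac{1}{c_2-\cfrac{1}{\ddots-\cfrac{1}{c_l}}}$ with integers $c_j\ge 2$. Put $M^-_q(c)=\begin{pmatrix}[c]_q & -q^{c-1}\\ 1 & 0\end{pmatrix}$ and define $\mathcal{R}_\alpha(q),\mathcal{S}_\alpha(q)$ by $\begin{pmatrix}\mathcal{R}_\alpha(q)\\ \mathcal{S}_\alpha(q)\end{pmatrix}=M^-_q(c_1)\cdots M^-_q(c_l)\begin{pmatrix}1\\0\end{pmatrix}$. For rational $\alpha\le 1$ these are defined recursively by $\mathcal{S}_\alpha(q)=\mathcal{S}_{\alpha+1}(q)$ and $\mathcal{R}_\alpha(q)=q^{ -1}(\mathcal{R}_{\alpha+1}(q)-\mathcal{S}_{\alpha+1}(q))$; $\mathcal{S}_\alpha(q)\in\mathbb Z[q]$ always. A polynomial $f(q)$ is palindromic if $f^\vee(q)=f(q)$, where $f^\vee(q)=q^{\deg f}f(q^{ -1})$. An irreducible fraction $\frac{r}{s}$ means $\gcd(r,s)=1$, $s>0$. -}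

module Defs where

open import Data.Nat as ℕ using (ℕ; zero; suc)
open import Data.Integer as ℤ using (ℤ; +_; ∣_∣)
open import Data.List using (List; []; _∷_; _++_; replicate; reverse; map)
open import Data.Product using (_×_; _,_; proj₂)
open import Relation.Nullary using (yes; no)
open import Relation.Nullary.Decidable using (does)
open import Data.Bool using (if_then_else_)
open import Relation.Binary.PropositionalEquality using (_≡_)

-- Polynomials in ℤ[q] as coefficient lists, constant term first
-- (trailing zeros allowed).

Poly : Set
Poly = List ℤ

_⊕_ : Poly → Poly → Poly
[]       ⊕ g        = g
(a ∷ f)  ⊕ []       = a ∷ f
(a ∷ f)  ⊕ (b ∷ g)  = (a ℤ.+ b) ∷ (f ⊕ g)

neg : Poly → Poly
neg = map (λ x → ℤ.- x)

_⊗_ : Poly → Poly → Poly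
[]      ⊗ g = []
(a ∷ f) ⊗ g = map (a ℤ.*_) g ⊕ (+ 0 ∷ (f ⊗ g))

shiftq : ℕ → Poly → Poly
shiftq k f = replicate k (+ 0) ++ f

qint : ℕ → Poly
qint c = replicate c (+ 1)

dropZeros : Poly → Poly
dropZeros []      = []
dropZeros (a ∷ f) with a ℤ.≟ + 0
... | yes _ = dropZeros f
... | no  _ = a ∷ f

strip : Poly → Poly
strip f = reverse (dropZeros (reverse f))

-- f palindromic: f^∨(q) = q^(deg f) f(q⁻¹) equals f, i.e. the reversed
-- (trailing-zero-free) coefficient list equals itself.
Palindromic : Poly → Set
Palindromic f = reverse (strip f) ≡ strip f

-- Negative continued fraction expansion of r/s > 1 (r > s ≥ 1, coprime):
-- c₁ = ⌈r/s⌉, and r/s = c₁ - 1/(s/(c₁ s - r)); stop when c₁ s - r = 0.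
-- The fuel argument is only used for termination (denominators strictly
-- decrease, so fuel s+1 always suffices).

negCF : ℕ → ℕ → ℕ → List ℕ
negCF zero       r s = []
negCF (suc fuel) r zero = []
negCF (suc fuel) r (suc s') =
  let s = suc s'
      c = (r ℕ.+ s') ℕ./ s
      d = c ℕ.* s ℕ.∸ r
  in if does (d ℕ.≟ 0) then c ∷ [] else c ∷ negCF fuel s d

negCFexp : ℕ → ℕ → List ℕ
negCFexp r s = negCF (suc s) r s

-- (R, S) = M⁻_q(c₁) ⋯ M⁻_q(cₗ) (1, 0)ᵀ,
-- M⁻_q(c) = [[ [c]_q , -q^(c-1) ], [ 1 , 0 ]]
matVec : List ℕ → Poly × Poly
matVec []       = (+ 1 ∷ []) , []
matVec (c ∷ cs) with matVec cs
... | R' , S' = ((qint c ⊗ R') ⊕ neg (shiftq (c ℕ.∸ 1) S')) , R'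

S>1 : ℕ → ℕ → Poly
S>1 r s = proj₂ (matVec (negCFexp r s))

-- S_{r/s} for arbitrary integer r and s ≥ 1: if r/s > 1 use the
-- continued fraction; otherwise S_{r/s} = S_{(r+s)/s}.  The fuel
-- (∣r∣ + 3 suffices) only ensures termination.
Sgo : ℕ → ℤ → ℕ → Poly
Sgo zero       r s = []
Sgo (suc fuel) r s with + s ℤ.<? r
... | yes _ = S>1 ∣ r ∣ s
... | no  _ = Sgo fuel (r ℤ.+ + s) s

Sq : ℤ → ℕ → Poly
Sq r s = Sgo (∣ r ∣ ℕ.+ 3) r s

{-# OPTIONS --safe #-}
module Submission where

-- Let d = ⌈r/s⌉ s − r and s/d = c₁ − 1/(c₂ − …).  Then S_{r/s} is the top left entry R of
-- M_q(c₁) ⋯ M_q(cₗ), and at q = 1 this product is [[s, −d′], [d, −e′]].  Its determinant is 1, so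
-- d d′ ≡ 1 (mod s), and r² ≡ 1 (mod s) amounts to d = d′.
-- If d = d′, then s/d and s/d′ have the same expansion; as the expansion of s/d′ is the reversed
-- one and reversing the expansion replaces R by q^(deg R) R(q⁻¹), R is palindromic.
-- Conversely, 2 R′(1) = deg R · R(1) + d − d′, and a palindromic R satisfies 2 R′(1) = deg R · R(1).

open import Defs
open import Data.Nat as ℕ using (ℕ; zero; suc; _>_; s≤s; z≤n)
import Data.Nat.Properties as ℕ
import Data.Nat.DivMod as ℕ
import Data.Nat.Divisibility as ℕ
open import Data.Nat.Coprimality using (Coprime)
open import Data.Integer as ℤ using (ℤ; +_; -[1+_]; ∣_∣; _+_; _*_; _-_; -_; _≤_; _<_; pred)
import Data.Integer.Properties as ℤ
open import Algebra.Properties.AbelianGroup ℤ.+-0-abelianGroup using () renaming (∙-cancelˡ to +-cancelˡ)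
open import Data.Integer.Divisibility using (_∣_)
import Data.Integer.Divisibility.Signed as Signed
open import Data.Integer.Tactic.RingSolver using (solve-∀)
open import Data.List using (List; []; _∷_; _∷ʳ_; [_]; replicate; reverse; map; foldr; length)
open import Data.Nat.ListAction using (sum)
import Data.List.Properties as List
open import Data.List.Relation.Unary.All using (All; []; _∷_)
open import Data.Product using (_×_; _,_; proj₁; proj₂; ∃)
open import Data.List.Relation.Binary.Permutation.Propositional using (↭-sym)
open import Data.List.Relation.Binary.Permutation.Propositional.Properties using (All-resp-↭; ↭-reverse)
open import Relation.Binary.Definitions using (tri<; tri≈; tri>)
open import Data.Bool using (if_then_else_)
open import Relation.Nullary.Decidable using (does)
open import Function.Bundles using (_⇔_; mk⇔; Equivalence)
open import Relation.Nullary using (yes; no; contradiction)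
open import Relation.Binary.PropositionalEquality
  using (_≡_; refl; sym; trans; cong; cong₂; subst; subst₂; module ≡-Reasoning)

open ≡-Reasoning

-- Continued fractions at q = 1

-- For the converse, palindromicity only says that `cs` and its reversal have the same R, and R by
-- itself does not visibly determine the expansion. A linear functional of R that sees d - d′ is
-- enough, and the derivative at q = 1 is one. The formula for it comes from the normalised matrices
-- q^(-(c-1)/2) M_q(c): twice their derivative at q = 1 is X M(c) - M(c) X with X = [[0, 1],
-- [-1, 1]], the same X for every c. In a product P these commutators telescope to X P - P X, whose
-- left column is (d - d′, d - s - e′); `deriv₁-matVec` is that column with the normalisation
-- undone. Two models of polynomials are used. Coefficient functions on ℤ make shifts and the
-- reflection i ↦ k - i total, but hide the degree; lists supply degrees and leading coefficients.

stepℤ : ℕ → ℤ × ℤ → ℤ × ℤ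
stepℤ c (x , y) = + c * x - y , x

-- The two columns of M(c₁) ⋯ M(cₗ) at q = 1, the second one with opposite sign.
val val⁻ : List ℕ → ℤ × ℤ
val  = foldr stepℤ (+ 1 , + 0)
val⁻ = foldr stepℤ (+ 0 , - + 1)

num den num⁻ den⁻ : List ℕ → ℤ
num cs  = proj₁ (val cs)
den cs  = proj₂ (val cs)
num⁻ cs = proj₁ (val⁻ cs)
den⁻ cs = proj₂ (val⁻ cs)

det : ∀ cs → num cs * den⁻ cs ≡ den cs * num⁻ cs - + 1
det []       = refl
det (c ∷ cs) = begin
  (+ c * s - d) * d′       ≡⟨ lemma₁ (+ c) s d d′ ⟩
  + c * (s * d′) - d * d′  ≡⟨ lemma₂ (+ c) s d d′ e′ (det cs) ⟩
  s * (+ c * d′ - e′) - + 1 ∎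
  where
  s = num cs
  d = den cs
  d′ = num⁻ cs
  e′ = den⁻ cs
  lemma₁ : ∀ c s d d′ → (c * s - d) * d′ ≡ c * (s * d′) - d * d′
  lemma₁ = solve-∀
  lemma₂ : ∀ c s d d′ e′ → s * e′ ≡ d * d′ - + 1 →
           c * (s * d′) - d * d′ ≡ s * (c * d′ - e′) - + 1
  lemma₂ c s d d′ e′ eq = begin
    c * (s * d′) - d * d′                       ≡⟨ p c s d d′ ⟩
    c * (s * d′) - (d * d′ - + 1) - + 1         ≡⟨ cong (λ z → c * (s * d′) - z - + 1) eq ⟨
    c * (s * d′) - s * e′ - + 1                 ≡⟨ q c s d′ e′ ⟩
    s * (c * d′ - e′) - + 1                     ∎
    where
    p : ∀ c s d d′ → c * (s * d′) - d * d′ ≡ c * (s * d′) - (d * d′ - + 1) - + 1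
    p = solve-∀
    q : ∀ c s d′ e′ → c * (s * d′) - s * e′ - + 1 ≡ s * (c * d′ - e′) - + 1
    q = solve-∀

-- Associativity in the upper left entry: prepending `a` combines rows, appending `c` combines
-- columns, and the two commute.
linear-step : ∀ a c x y x⁻ y⁻ →
  a * (c * x - x⁻) - (c * y - y⁻) ≡ c * (a * x - y) - (a * x⁻ - y⁻)
linear-step = solve-∀

val-∷ʳ : ∀ cs c → val (cs ∷ʳ c) ≡ (+ c * num cs - num⁻ cs , + c * den cs - den⁻ cs)
val-∷ʳ []       c = cong (+ c * + 1 - + 0 ,_) (p (+ c))
  where
  p : ∀ c → + 1 ≡ c * + 0 - - + 1
  p = solve-∀
val-∷ʳ (a ∷ cs) c rewrite val-∷ʳ cs c =
  cong (_, _) (linear-step (+ a) (+ c) (num cs) (den cs) (num⁻ cs) (den⁻ cs))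

val⁻-∷ʳ : ∀ cs c → val⁻ (cs ∷ʳ c) ≡ val cs
val⁻-∷ʳ []       c = cong (_, + 0) (p (+ c))
  where
  p : ∀ c → c * + 0 - - + 1 ≡ + 1
  p = solve-∀
val⁻-∷ʳ (a ∷ cs) c rewrite val⁻-∷ʳ cs c = refl

-- With J = diag(1, -1), J M(c)ᵀ J = M(c). So reversing the list replaces the product P by J Pᵀ J,
-- which exchanges d and d′.
val-reverse : ∀ cs → val (reverse cs) ≡ (num cs , num⁻ cs)
                   × val⁻ (reverse cs) ≡ (den cs , den⁻ cs)
val-reverse []       = refl , refl
val-reverse (c ∷ cs)
  rewrite List.unfold-reverse c cs | val-∷ʳ (reverse cs) c | val⁻-∷ʳ (reverse cs) c
        | proj₁ (val-reverse cs) | proj₂ (val-reverse cs) = refl , refl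

Valid : List ℕ → Set
Valid = All (2 ℕ.≤_)

-- The bound reproduces itself: c ≥ 2 and d < s give c s - d ≥ 2 s - d > s.
0≤den<num : ∀ {cs} → Valid cs → + 0 ≤ den cs × den cs < num cs
0≤den<num []                          = ℤ.+≤+ z≤n , ℤ.+<+ (s≤s z≤n)
0≤den<num {suc (suc k) ∷ cs} (s≤s (s≤s z≤n) ∷ v) with 0≤den<num v
... | 0≤d , d<s = 0≤s , ℤ.<-≤-trans lower upper
  where
  s = num cs
  d = den cs
  0≤s = ℤ.≤-trans 0≤d (ℤ.<⇒≤ d<s)
  p : ∀ s d → (d + s) - d ≡ s
  p = solve-∀
  q : ∀ s d → (s + s) - d ≡ + 2 * s - d
  q = solve-∀
  lower : s < + 2 * s - d
  lower = subst₂ _<_ (p s d) (q s d) (ℤ.+-monoˡ-< (- d) (ℤ.+-monoˡ-< s d<s))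
  upper : + 2 * s - d ≤ + suc (suc k) * s - d
  upper = ℤ.+-monoˡ-≤ (- d) (ℤ.*-monoʳ-≤-nonNeg s {{ℤ.nonNegative 0≤s}} (ℤ.+≤+ {2} {suc (suc k)} (s≤s (s≤s z≤n))))

quotient-< : ∀ {c c′ s d d′} → + 0 ≤ d → d′ < s → + 0 ≤ s → c ℕ.< c′ →
             + c * s - d < + c′ * s - d′
quotient-< {c} {c′} {s} {d} {d′} 0≤d d′<s 0≤s c<c′ =
  ℤ.≤-<-trans (ℤ.+-monoʳ-≤ (+ c * s) (ℤ.neg-mono-≤ 0≤d))
    (ℤ.<-≤-trans
      (subst₂ _<_ (p (+ c) s d′) (q (+ c) s d′) (ℤ.+-monoʳ-< (+ c * s - d′) d′<s))
      (ℤ.+-monoˡ-≤ (- d′) (ℤ.*-monoʳ-≤-nonNeg s {{ℤ.nonNegative 0≤s}} (ℤ.+≤+ c<c′))))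
  where
  p : ∀ c s d′ → (c * s - d′) + d′ ≡ c * s - + 0
  p = solve-∀
  q : ∀ c s d′ → (c * s - d′) + s ≡ (+ 1 + c) * s - d′
  q = solve-∀

-- Both `c` and `c′` are the ceiling of the same number divided by s.
quotient-unique : ∀ {c c′ s d d′} → + 0 ≤ d → d < s → + 0 ≤ d′ → d′ < s →
                  + c * s - d ≡ + c′ * s - d′ → c ≡ c′
quotient-unique {c} {c′} 0≤d d<s 0≤d′ d′<s eq with ℕ.<-cmp c c′
... | tri< c<c′ _ _ = contradiction eq (ℤ.<⇒≢ (quotient-< 0≤d d′<s (ℤ.≤-trans 0≤d (ℤ.<⇒≤ d<s)) c<c′))
... | tri≈ _ c≡c′ _ = c≡c′
... | tri> _ _ c>c′ = contradiction (sym eq) (ℤ.<⇒≢ (quotient-< 0≤d′ d<s (ℤ.≤-trans 0≤d (ℤ.<⇒≤ d<s)) c>c′))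

0<num : ∀ {cs} → Valid cs → + 0 < num cs
0<num v = ℤ.≤-<-trans (proj₁ (0≤den<num v)) (proj₂ (0≤den<num v))

-- The first entry is a ceiling, hence determined by the pair. The empty list is recognised by its
-- denominator 0: the denominator of a nonempty list is the numerator of its tail, which is
-- positive.
val-injective : ∀ {cs ds} → Valid cs → Valid ds → val cs ≡ val ds → cs ≡ ds
val-injective []      []      _  = refl
val-injective []      (_ ∷ w) eq = contradiction (cong proj₂ eq) (ℤ.<⇒≢ (0<num w))
val-injective (_ ∷ v) []      eq = contradiction (sym (cong proj₂ eq)) (ℤ.<⇒≢ (0<num v))
val-injective {c ∷ cs} {c′ ∷ ds} (_ ∷ v) (_ ∷ w) eq =
  cong₂ _∷_ c≡c′ (val-injective v w (cong₂ _,_ s≡s′ d≡d′))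
  where
  s≡s′ : num cs ≡ num ds
  s≡s′ = cong proj₂ eq
  eq₁ : + c * num cs - den cs ≡ + c′ * num cs - den ds
  eq₁ = trans (cong proj₁ eq) (cong (λ z → + c′ * z - den ds) (sym s≡s′))
  c≡c′ : c ≡ c′
  c≡c′ = quotient-unique (proj₁ (0≤den<num v)) (proj₂ (0≤den<num v)) (proj₁ (0≤den<num w))
           (subst (den ds <_) (sym s≡s′) (proj₂ (0≤den<num w))) eq₁
  d≡d′ : den cs ≡ den ds
  d≡d′ = ℤ.neg-injective (+-cancelˡ (+ c * num cs) _ _
           (trans eq₁ (cong (λ z → + z * num cs - den ds) (sym c≡c′))))

reverse-valid : ∀ {cs} → Valid cs → Valid (reverse cs)
reverse-valid {cs} = All-resp-↭ (↭-sym (↭-reverse cs))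

-- Laurent polynomials as coefficient functions

Coeffs : Set
Coeffs = ℤ → ℤ

-- Multiplication by [c]_q; multiplication by q^k is precomposition with _- + k.
qbox : ℕ → Coeffs → Coeffs
qbox zero    f i = + 0
qbox (suc c) f i = f i + qbox c f (pred i)

qbox-cong : ∀ c {f g} → (∀ i → f i ≡ g i) → ∀ i → qbox c f i ≡ qbox c g i
qbox-cong zero    eq i = refl
qbox-cong (suc c) eq i = cong₂ _+_ (eq i) (qbox-cong c eq (pred i))

qbox-minus : ∀ c f g i → qbox c (λ j → f j - g j) i ≡ qbox c f i - qbox c g i
qbox-minus zero    f g i = refl
qbox-minus (suc c) f g i = trans (cong (λ z → f i - g i + z) (qbox-minus c f g (pred i)))
  (p (f i) (g i) (qbox c f (pred i)) (qbox c g (pred i)))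
  where
  p : ∀ a b x y → a - b + (x - y) ≡ (a + x) - (b + y)
  p = solve-∀

pred-minus : ∀ i k → pred i - k ≡ pred (i - k)
pred-minus i k = ℤ.pred-+ i (- k)

qbox-shift : ∀ c k f i → qbox c (λ j → f (j - k)) i ≡ qbox c f (i - k)
qbox-shift zero    k f i = refl
qbox-shift (suc c) k f i =
  cong (λ z → f (i - k) + z) (trans (qbox-shift c k f (pred i)) (cong (qbox c f) (pred-minus i k)))

qbox-zero : ∀ c i → qbox c (λ _ → + 0) i ≡ + 0
qbox-zero zero    i = refl
qbox-zero (suc c) i = trans (ℤ.+-identityˡ _) (qbox-zero c (pred i))

qbox-plus : ∀ c f g i → qbox c (λ j → f j + g j) i ≡ qbox c f i + qbox c g i
qbox-plus zero    f g i = refl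
qbox-plus (suc c) f g i = trans (cong (λ z → f i + g i + z) (qbox-plus c f g (pred i)))
  (p (f i) (g i) (qbox c f (pred i)) (qbox c g (pred i)))
  where
  p : ∀ a b x y → a + b + (x + y) ≡ (a + x) + (b + y)
  p = solve-∀

qbox-pred : ∀ c f i → qbox c (λ j → f (pred j)) i ≡ qbox c f (pred i)
qbox-pred zero    f i = refl
qbox-pred (suc c) f i = cong (λ z → f (pred i) + z) (qbox-pred c f (pred i))

qbox-comm : ∀ a c f i → qbox a (qbox c f) i ≡ qbox c (qbox a f) i
qbox-comm zero    c f i = sym (qbox-zero c i)
qbox-comm (suc a) c f i = begin
  qbox c f i + qbox a (qbox c f) (pred i)        ≡⟨ cong (λ z → qbox c f i + z) (qbox-comm a c f (pred i)) ⟩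
  qbox c f i + qbox c (qbox a f) (pred i)        ≡⟨ cong (λ z → qbox c f i + z) (qbox-pred c (qbox a f) i) ⟨
  qbox c f i + qbox c (λ j → qbox a f (pred j)) i ≡⟨ qbox-plus c f (λ j → qbox a f (pred j)) i ⟨
  qbox c (qbox (suc a) f) i                      ∎

-- The splitting [c+1]_q = [c]_q + q^c at the top, whereas `qbox` splits as 1 + q [c]_q at the
-- bottom. Reflection exchanges the two.
qbox-last : ∀ c f i → qbox (suc c) f i ≡ qbox c f i + f (i - + c)
qbox-last zero    f i = trans (ℤ.+-comm (f i) (+ 0)) (cong (λ z → + 0 + f z) (sym (ℤ.+-identityʳ i)))
qbox-last (suc c) f i = begin
  f i + qbox (suc c) f (pred i)                ≡⟨ cong (λ z → f i + z) (qbox-last c f (pred i)) ⟩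
  f i + (qbox c f (pred i) + f (pred i - + c)) ≡⟨ ℤ.+-assoc (f i) _ _ ⟨
  f i + qbox c f (pred i) + f (pred i - + c)   ≡⟨ cong (λ z → qbox (suc c) f i + f z) (p i (+ c)) ⟩
  qbox (suc c) f i + f (i - + suc c)           ∎
  where
  p : ∀ i c → - + 1 + i - c ≡ i - (+ 1 + c)
  p = solve-∀

coeff : Poly → Coeffs
coeff f       -[1+ n ]  = + 0
coeff []      (+ n)     = + 0
coeff (a ∷ f) (+ zero)  = a
coeff (a ∷ f) (+ suc n) = coeff f (+ n)

-- The matrix product over Laurent polynomials and its reversal

stepq : ℕ → Coeffs × Coeffs → Coeffs × Coeffs
stepq c (u , v) = (λ i → qbox c u i - v (i - + (c ℕ.∸ 1))) , u

colq colq⁻ : List ℕ → Coeffs × Coeffs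
colq  = foldr stepq (coeff [ + 1 ] , λ _ → + 0)
colq⁻ = foldr stepq ((λ _ → + 0) , λ i → - coeff [ + 1 ] i)

numq denq numq⁻ denq⁻ : List ℕ → Coeffs
numq cs  = proj₁ (colq cs)
denq cs  = proj₂ (colq cs)
numq⁻ cs = proj₁ (colq⁻ cs)
denq⁻ cs = proj₂ (colq⁻ cs)

-- The first column after right multiplication by M_q(c). The two rows go together because the lower
-- row for `a ∷ cs` is the upper row for `cs`.
colq-∷ʳ : ∀ cs c →
  (∀ i → numq (cs ∷ʳ c) i ≡ qbox c (numq cs) i - numq⁻ cs i) ×
  (∀ i → denq (cs ∷ʳ c) i ≡ qbox c (denq cs) i - denq⁻ cs i)
colq-∷ʳ []       c = (λ _ → refl) , λ i →
  trans (p (coeff [ + 1 ] i)) (cong (λ z → z - - coeff [ + 1 ] i) (sym (qbox-zero c i)))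
  where
  p : ∀ x → x ≡ + 0 - - x
  p = solve-∀
colq-∷ʳ (a ∷ cs) c = first , proj₁ (colq-∷ʳ cs c)
  where
  k = + (a ℕ.∸ 1)
  u = numq cs
  v = denq cs
  u⁻ = numq⁻ cs
  v⁻ = denq⁻ cs
  p : ∀ a b c d → (a - b) - (c - d) ≡ (a - c) - (b - d)
  p = solve-∀
  first : ∀ i → numq (a ∷ cs ∷ʳ c) i ≡ qbox c (numq (a ∷ cs)) i - numq⁻ (a ∷ cs) i
  first i = begin
    qbox a (numq (cs ∷ʳ c)) i - denq (cs ∷ʳ c) (i - k)
      ≡⟨ cong₂ _-_ (qbox-cong a (proj₁ (colq-∷ʳ cs c)) i) (proj₂ (colq-∷ʳ cs c) (i - k)) ⟩
    qbox a (λ j → qbox c u j - u⁻ j) i - (qbox c v (i - k) - v⁻ (i - k))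
      ≡⟨ cong (_- (qbox c v (i - k) - v⁻ (i - k))) (qbox-minus a (qbox c u) u⁻ i) ⟩
    (qbox a (qbox c u) i - qbox a u⁻ i) - (qbox c v (i - k) - v⁻ (i - k))
      ≡⟨ p (qbox a (qbox c u) i) _ _ _ ⟩
    (qbox a (qbox c u) i - qbox c v (i - k)) - numq⁻ (a ∷ cs) i
      ≡⟨ cong₂ (λ x y → x - y - numq⁻ (a ∷ cs) i) (qbox-comm a c u i) (sym (qbox-shift c k v i)) ⟩
    (qbox c (qbox a u) i - qbox c (λ j → v (j - k)) i) - numq⁻ (a ∷ cs) i
      ≡⟨ cong (_- numq⁻ (a ∷ cs) i) (qbox-minus c (qbox a u) (λ j → v (j - k)) i) ⟨
    qbox c (numq (a ∷ cs)) i - numq⁻ (a ∷ cs) i ∎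

colq⁻-∷ʳ : ∀ cs c →
  (∀ i → numq⁻ (cs ∷ʳ c) i ≡ numq cs (i - + (c ℕ.∸ 1))) ×
  (∀ i → denq⁻ (cs ∷ʳ c) i ≡ denq cs (i - + (c ℕ.∸ 1)))
colq⁻-∷ʳ []       c = (λ i → trans (cong (λ z → z - - coeff [ + 1 ] (i - + (c ℕ.∸ 1))) (qbox-zero c i)) (p _)) ,
                      λ _ → refl
  where
  p : ∀ x → + 0 - - x ≡ x
  p = solve-∀
colq⁻-∷ʳ (a ∷ cs) c = first , proj₁ (colq⁻-∷ʳ cs c)
  where
  k = + (a ℕ.∸ 1)
  l = + (c ℕ.∸ 1)
  p : ∀ i k l → i - k - l ≡ i - l - k
  p = solve-∀
  first : ∀ i → numq⁻ (a ∷ cs ∷ʳ c) i ≡ numq (a ∷ cs) (i - l)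
  first i = cong₂ _-_
    (trans (qbox-cong a (proj₁ (colq⁻-∷ʳ cs c)) i) (qbox-shift a l (numq cs) i))
    (trans (proj₂ (colq⁻-∷ʳ cs c) (i - k)) (cong (denq cs) (p i k l)))

-- g(q) = q^k f(q⁻¹)
Mirror : ℤ → Coeffs → Coeffs → Set
Mirror k f g = ∀ i j → i + j ≡ k → f i ≡ g j

-- [c]_q is palindromic of degree c - 1, which is added to k. For c = 0 both sides vanish, so the
-- degree -1 does no harm.
mirror-qbox : ∀ c {k f g} → Mirror k f g → Mirror (+ c - + 1 + k) (qbox c f) (qbox c g)
mirror-qbox zero    m i j eq = refl
mirror-qbox (suc c) {k} {f} {g} m i j eq = begin
  f i + qbox c f (pred i)    ≡⟨ cong₂ _+_ (m i (j - + c) (p i j (+ c) k eq))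
                                          (mirror-qbox c m (pred i) j (q i j (+ c) k eq)) ⟩
  g (j - + c) + qbox c g j   ≡⟨ ℤ.+-comm (g (j - + c)) _ ⟩
  qbox c g j + g (j - + c)   ≡⟨ qbox-last c g j ⟨
  qbox (suc c) g j           ∎
  where
  p : ∀ i j c k → i + j ≡ + 1 + c - + 1 + k → i + (j - c) ≡ k
  p i j c k eq = trans (p₁ i j c) (trans (cong (_- c) eq) (p₂ c k))
    where
    p₁ : ∀ i j c → i + (j - c) ≡ i + j - c
    p₁ = solve-∀
    p₂ : ∀ c k → + 1 + c - + 1 + k - c ≡ k
    p₂ = solve-∀
  q : ∀ i j c k → i + j ≡ + 1 + c - + 1 + k → - + 1 + i + j ≡ c - + 1 + k
  q i j c k eq = trans (q₁ i j) (trans (cong (λ z → - + 1 + z) eq) (q₂ c k))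
    where
    q₁ : ∀ i j → - + 1 + i + j ≡ - + 1 + (i + j)
    q₁ = solve-∀
    q₂ : ∀ c k → - + 1 + (+ 1 + c - + 1 + k) ≡ c - + 1 + k
    q₂ = solve-∀

mirror-constant : ∀ a → Mirror (+ 0) (coeff [ a ]) (coeff [ a ])
mirror-constant a (+ zero)  (+ zero)     eq = refl
mirror-constant a (+ suc i) -[1+ j ]     eq = refl
mirror-constant a -[1+ i ]  (+ suc j)    eq = refl

deg : List ℕ → ℕ
deg cs = sum (map (ℕ._∸ 1) cs)

-- The q-version of `val-reverse`: M_q(c) = q^(c-1) J M_(1/q)(c)ᵀ J with J = diag(1, -1). The powers
-- of q multiply up to q^(deg cs), so both entries are reflected with the same k, although the lower
-- one has smaller degree.
mirror-reverse : ∀ {cs} → Valid cs →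
  Mirror (+ deg cs) (numq cs) (numq (reverse cs)) ×
  Mirror (+ deg cs) (denq cs) (numq⁻ (reverse cs))
mirror-reverse []                = mirror-constant (+ 1) , λ _ _ _ → refl
mirror-reverse {suc c ∷ cs} (_ ∷ v) rewrite List.unfold-reverse (suc c) cs = first , second
  where
  m₁ = proj₁ (mirror-reverse v)
  m₂ = proj₂ (mirror-reverse v)
  n = + deg cs
  p : ∀ i j → i + j ≡ + c + n → i - + c + j ≡ n
  p i j eq = trans (p₁ i j (+ c)) (trans (cong (_- + c) eq) (p₂ (+ c) n))
    where
    p₁ : ∀ i j c → i - c + j ≡ i + j - c
    p₁ = solve-∀
    p₂ : ∀ c n → c + n - c ≡ n
    p₂ = solve-∀
  first : Mirror (+ c + n) (numq (suc c ∷ cs)) (numq (reverse cs ∷ʳ suc c))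
  first i j eq = trans
    (cong₂ _-_ (mirror-qbox (suc c) m₁ i j eq) (m₂ (i - + c) j (p i j eq)))
    (sym (proj₁ (colq-∷ʳ (reverse cs) (suc c)) j))
  second : Mirror (+ c + n) (numq cs) (numq⁻ (reverse cs ∷ʳ suc c))
  second i j eq = trans
    (m₁ i (j - + c) (trans (ℤ.+-comm i _) (p j i (trans (ℤ.+-comm j i) eq))))
    (sym (proj₁ (colq⁻-∷ʳ (reverse cs) (suc c)) j))

-- Coefficient lists and their coefficient functions

coeff-∷ : ∀ a f i → coeff (a ∷ f) i ≡ coeff [ a ] i + coeff f (pred i)
coeff-∷ a f -[1+ n ]    = refl
coeff-∷ a f (+ zero)    = sym (ℤ.+-identityʳ a)
coeff-∷ a f (+ suc n)   = sym (ℤ.+-identityˡ _)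

coeff-0∷ : ∀ f i → coeff (+ 0 ∷ f) i ≡ coeff f (pred i)
coeff-0∷ f -[1+ n ]  = refl
coeff-0∷ f (+ zero)  = refl
coeff-0∷ f (+ suc n) = refl

coeff-⊕ : ∀ f g i → coeff (f ⊕ g) i ≡ coeff f i + coeff g i
coeff-⊕ f       g       -[1+ n ]  = refl
coeff-⊕ []      g       (+ n)     = sym (ℤ.+-identityˡ _)
coeff-⊕ (a ∷ f) []      (+ n)     = sym (ℤ.+-identityʳ _)
coeff-⊕ (a ∷ f) (b ∷ g) (+ zero)  = refl
coeff-⊕ (a ∷ f) (b ∷ g) (+ suc n) = coeff-⊕ f g (+ n)

coeff-map : ∀ {h : ℤ → ℤ} → h (+ 0) ≡ + 0 → ∀ f i → coeff (map h f) i ≡ h (coeff f i)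
coeff-map h0 f       -[1+ n ]  = sym h0
coeff-map h0 []      (+ n)     = sym h0
coeff-map h0 (a ∷ f) (+ zero)  = refl
coeff-map h0 (a ∷ f) (+ suc n) = coeff-map h0 f (+ n)

coeff-shiftq : ∀ k f i → coeff (shiftq k f) i ≡ coeff f (i - + k)
coeff-shiftq zero    f i = cong (coeff f) (sym (ℤ.+-identityʳ i))
coeff-shiftq (suc k) f i = begin
  coeff (+ 0 ∷ shiftq k f) i ≡⟨ coeff-0∷ (shiftq k f) i ⟩
  coeff (shiftq k f) (pred i) ≡⟨ coeff-shiftq k f (pred i) ⟩
  coeff f (pred i - + k)      ≡⟨ cong (coeff f) (p i (+ k)) ⟩
  coeff f (i - + suc k)       ∎
  where
  p : ∀ i k → - + 1 + i - k ≡ i - (+ 1 + k)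
  p = solve-∀

coeff-qint⊗ : ∀ c f i → coeff (qint c ⊗ f) i ≡ qbox c (coeff f) i
coeff-qint⊗ zero    f -[1+ n ] = refl
coeff-qint⊗ zero    f (+ n)    = refl
coeff-qint⊗ (suc c) f i        = begin
  coeff (map (+ 1 *_) f ⊕ (+ 0 ∷ (qint c ⊗ f))) i
    ≡⟨ coeff-⊕ (map (+ 1 *_) f) (+ 0 ∷ (qint c ⊗ f)) i ⟩
  coeff (map (+ 1 *_) f) i + coeff (+ 0 ∷ (qint c ⊗ f)) i
    ≡⟨ cong₂ _+_ (trans (coeff-map refl f i) (ℤ.*-identityˡ _))
                 (trans (coeff-0∷ (qint c ⊗ f) i) (coeff-qint⊗ c f (pred i))) ⟩
  qbox (suc c) (coeff f) i ∎

R S : List ℕ → Poly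
R cs = proj₁ (matVec cs)
S cs = proj₂ (matVec cs)

coeff-matVec : ∀ cs → (∀ i → coeff (R cs) i ≡ numq cs i) × (∀ i → coeff (S cs) i ≡ denq cs i)
coeff-matVec []       = (λ _ → refl) , λ { -[1+ n ] → refl ; (+ n) → refl }
coeff-matVec (c ∷ cs) = first , proj₁ (coeff-matVec cs)
  where
  k = c ℕ.∸ 1
  first : ∀ i → coeff (R (c ∷ cs)) i ≡ numq (c ∷ cs) i
  first i = begin
    coeff ((qint c ⊗ R cs) ⊕ neg (shiftq k (S cs))) i
      ≡⟨ coeff-⊕ (qint c ⊗ R cs) (neg (shiftq k (S cs))) i ⟩
    coeff (qint c ⊗ R cs) i + coeff (neg (shiftq k (S cs))) i
      ≡⟨ cong₂ _+_ (coeff-qint⊗ c (R cs) i)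
                   (trans (coeff-map refl (shiftq k (S cs)) i) (cong -_ (coeff-shiftq k (S cs) i))) ⟩
    qbox c (coeff (R cs)) i - coeff (S cs) (i - + k)
      ≡⟨ cong₂ _-_ (qbox-cong c (proj₁ (coeff-matVec cs)) i) (proj₂ (coeff-matVec cs) (i - + k)) ⟩
    numq (c ∷ cs) i ∎

-- Coefficient functions do not see trailing zeros, hence the condition on lengths.
coeff-injective : ∀ {f g} → length f ≡ length g → (∀ i → coeff f i ≡ coeff g i) → f ≡ g
coeff-injective {[]}    {[]}    _   _  = refl
coeff-injective {a ∷ f} {b ∷ g} len eq =
  cong₂ _∷_ (eq (+ 0)) (coeff-injective (ℕ.suc-injective len) eq′)
  where
  eq′ : ∀ i → coeff f i ≡ coeff g i
  eq′ -[1+ n ] = refl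
  eq′ (+ n)    = eq (+ suc n)

coeff-∷ʳ : ∀ f a i → coeff (f ∷ʳ a) i ≡ coeff f i + coeff [ a ] (i - + length f)
coeff-∷ʳ []      a i = trans (cong (coeff [ a ]) (sym (ℤ.+-identityʳ i))) (p i)
  where
  p : ∀ i → coeff [ a ] (i - + 0) ≡ coeff [] i + coeff [ a ] (i - + 0)
  p -[1+ n ] = sym (ℤ.+-identityˡ _)
  p (+ n)    = sym (ℤ.+-identityˡ _)
coeff-∷ʳ (b ∷ f) a i = begin
  coeff (b ∷ (f ∷ʳ a)) i
    ≡⟨ coeff-∷ b (f ∷ʳ a) i ⟩
  coeff [ b ] i + coeff (f ∷ʳ a) (pred i)
    ≡⟨ cong (λ z → coeff [ b ] i + z) (coeff-∷ʳ f a (pred i)) ⟩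
  coeff [ b ] i + (coeff f (pred i) + coeff [ a ] (pred i - + length f))
    ≡⟨ ℤ.+-assoc (coeff [ b ] i) _ _ ⟨
  coeff [ b ] i + coeff f (pred i) + coeff [ a ] (pred i - + length f)
    ≡⟨ cong₂ _+_ (sym (coeff-∷ b f i)) (cong (coeff [ a ]) (p i (+ length f))) ⟩
  coeff (b ∷ f) i + coeff [ a ] (i - + suc (length f)) ∎
  where
  p : ∀ i k → - + 1 + i - k ≡ i - (+ 1 + k)
  p = solve-∀

mirror-list : ∀ f → Mirror (+ length f - + 1) (coeff f) (coeff (reverse f))
mirror-list []      -[1+ i ] -[1+ j ] eq = refl
mirror-list []      -[1+ i ] (+ j)    eq = refl
mirror-list []      (+ i)    -[1+ j ] eq = refl
mirror-list []      (+ i)    (+ j)    eq = refl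
mirror-list (a ∷ f) i j eq = begin
  coeff (a ∷ f) i
    ≡⟨ coeff-∷ a f i ⟩
  coeff [ a ] i + coeff f (pred i)
    ≡⟨ cong₂ _+_ (mirror-constant a i (j - + length f) (p i j (+ length f) eq))
                 (mirror-list f (pred i) j (q i j (+ length f) eq)) ⟩
  coeff [ a ] (j - + length f) + coeff (reverse f) j
    ≡⟨ ℤ.+-comm (coeff [ a ] (j - + length f)) _ ⟩
  coeff (reverse f) j + coeff [ a ] (j - + length f)
    ≡⟨ cong (λ l → coeff (reverse f) j + coeff [ a ] (j - + l)) (List.length-reverse f) ⟨
  coeff (reverse f) j + coeff [ a ] (j - + length (reverse f))
    ≡⟨ coeff-∷ʳ (reverse f) a j ⟨
  coeff (reverse f ∷ʳ a) j
    ≡⟨ cong (λ g → coeff g j) (List.unfold-reverse a f) ⟨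
  coeff (reverse (a ∷ f)) j ∎
  where
  p : ∀ i j l → i + j ≡ + 1 + l - + 1 → i + (j - l) ≡ + 0
  p i j l eq = trans (sym (ℤ.+-assoc i j (- l))) (trans (cong (_- l) eq) (p′ l))
    where
    p′ : ∀ l → + 1 + l - + 1 - l ≡ + 0
    p′ = solve-∀
  q : ∀ i j l → i + j ≡ + 1 + l - + 1 → - + 1 + i + j ≡ l - + 1
  q i j l eq = trans (ℤ.+-assoc (- + 1) i j) (trans (cong (λ z → - + 1 + z) eq) (q′ l))
    where
    q′ : ∀ l → - + 1 + (+ 1 + l - + 1) ≡ l - + 1
    q′ = solve-∀

-- No trailing zeros, so that strip leaves f unchanged.
Monic : ℕ → Poly → Set
Monic n f = ∃ λ xs → f ≡ xs ∷ʳ + 1 × length xs ≡ n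

monic-⊕ˡ : ∀ {n f g} → Monic n f → length g ℕ.≤ n → Monic n (f ⊕ g)
monic-⊕ˡ {g = g} (xs , refl , refl) l = go xs g l
  where
  go : ∀ xs g → length g ℕ.≤ length xs → Monic (length xs) ((xs ∷ʳ + 1) ⊕ g)
  go []       []      _       = [] , refl , refl
  go (x ∷ xs) []      _       = x ∷ xs , refl , refl
  go (x ∷ xs) (b ∷ g) (s≤s l) with go xs g l
  ... | ys , eq , len = x + b ∷ ys , cong (x + b ∷_) eq , cong suc len

monic-⊕ʳ : ∀ {n f g} → Monic n f → length g ℕ.≤ n → Monic n (g ⊕ f)
monic-⊕ʳ {g = g} (xs , refl , refl) l = go xs g l
  where
  go : ∀ xs g → length g ℕ.≤ length xs → Monic (length xs) (g ⊕ (xs ∷ʳ + 1))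
  go xs       []      _       = xs , refl , refl
  go (x ∷ xs) (b ∷ g) (s≤s l) with go xs g l
  ... | ys , eq , len = b + x ∷ ys , cong (b + x ∷_) eq , cong suc len

monic-length : ∀ {n f} → Monic n f → length f ≡ suc n
monic-length (xs , refl , refl) = trans (List.length-++ xs) (ℕ.+-comm (length xs) 1)

map-1* : ∀ f → map (+ 1 *_) f ≡ f
map-1* f = trans (List.map-cong ℤ.*-identityˡ f) (List.map-id f)

monic-qint⊗ : ∀ c {n f} → Monic n f → Monic (c ℕ.+ n) (qint (suc c) ⊗ f)
-- `⊗` leaves a summand `[ + 0 ]` behind, which does not lengthen a nonempty list.
monic-qint⊗ zero    {f = f} m@(xs , refl , refl) = subst (Monic _) (go xs) m
  where
  go : ∀ xs → xs ∷ʳ + 1 ≡ map (+ 1 *_) (xs ∷ʳ + 1) ⊕ [ + 0 ]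
  go xs rewrite map-1* (xs ∷ʳ + 1) with xs
  ... | []          = refl
  ... | x ∷ []      = cong (_∷ [ + 1 ]) (sym (ℤ.+-identityʳ x))
  ... | x ∷ y ∷ ys  = cong (_∷ y ∷ ys ∷ʳ + 1) (sym (ℤ.+-identityʳ x))
monic-qint⊗ (suc c) {n} {f} m with monic-qint⊗ c m
... | ys , eq , len rewrite map-1* f =
  monic-⊕ʳ (+ 0 ∷ ys , cong (+ 0 ∷_) eq , cong suc len)
    (ℕ.≤-trans (ℕ.≤-reflexive (monic-length m)) (s≤s (ℕ.m≤n+m n c)))

-- The bound on S keeps q^(c-1) S below the leading term of [c]_q R. It is renewed because the next
-- S is the current R, of length deg cs + 1 ≤ (c - 1) + deg cs; this is where c ≥ 2 enters.
monic-R : ∀ {cs} → Valid cs → Monic (deg cs) (R cs) × length (S cs) ℕ.≤ deg cs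
monic-R []                                  = ([] , refl , refl) , z≤n
monic-R {suc (suc k) ∷ cs} (s≤s (s≤s z≤n) ∷ v) with monic-R v
... | m , l = monic-⊕ˡ (monic-qint⊗ (suc k) m) len₁ , len₂
  where
  len₁ : length (neg (shiftq (suc k) (S cs))) ℕ.≤ suc k ℕ.+ deg cs
  len₁ = ℕ.≤-trans (ℕ.≤-reflexive (begin
    length (neg (shiftq (suc k) (S cs)))                ≡⟨ List.length-map _ (shiftq (suc k) (S cs)) ⟩
    length (shiftq (suc k) (S cs))                      ≡⟨ List.length-++ (replicate (suc k) (+ 0)) ⟩
    length (replicate (suc k) (+ 0)) ℕ.+ length (S cs)  ≡⟨ cong (ℕ._+ length (S cs)) (List.length-replicate (suc k)) ⟩
    suc k ℕ.+ length (S cs)                             ∎)) (ℕ.+-monoʳ-≤ (suc k) l)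
  len₂ : length (R cs) ℕ.≤ suc k ℕ.+ deg cs
  len₂ = ℕ.≤-trans (ℕ.≤-reflexive (monic-length m)) (s≤s (ℕ.m≤n+m (deg cs) k))

strip-monic : ∀ {n f} → Monic n f → strip f ≡ f
strip-monic (xs , refl , _) rewrite List.reverse-++ xs [ + 1 ] = begin
  reverse (+ 1 ∷ reverse xs)     ≡⟨ List.unfold-reverse (+ 1) (reverse xs) ⟩
  reverse (reverse xs) ∷ʳ + 1    ≡⟨ cong (_∷ʳ + 1) (List.reverse-involutive xs) ⟩
  xs ∷ʳ + 1                      ∎

-- Values and derivatives at q = 1

eval₁ deriv₁ : Poly → ℤ
eval₁ []      = + 0
eval₁ (a ∷ f) = a + eval₁ f
deriv₁ []      = + 0
deriv₁ (a ∷ f) = deriv₁ f + eval₁ f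

interchange : ∀ a b x y → a + b + (x + y) ≡ (a + x) + (b + y)
interchange = solve-∀

eval₁-⊕ : ∀ f g → eval₁ (f ⊕ g) ≡ eval₁ f + eval₁ g
eval₁-⊕ []      g       = sym (ℤ.+-identityˡ _)
eval₁-⊕ (a ∷ f) []      = sym (ℤ.+-identityʳ _)
eval₁-⊕ (a ∷ f) (b ∷ g) =
  trans (cong (λ z → a + b + z) (eval₁-⊕ f g)) (interchange a b (eval₁ f) (eval₁ g))

deriv₁-⊕ : ∀ f g → deriv₁ (f ⊕ g) ≡ deriv₁ f + deriv₁ g
deriv₁-⊕ []      g       = sym (ℤ.+-identityˡ _)
deriv₁-⊕ (a ∷ f) []      = sym (ℤ.+-identityʳ _)
deriv₁-⊕ (a ∷ f) (b ∷ g) =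
  trans (cong₂ _+_ (deriv₁-⊕ f g) (eval₁-⊕ f g))
        (interchange (deriv₁ f) (deriv₁ g) (eval₁ f) (eval₁ g))

eval₁-neg : ∀ f → eval₁ (neg f) ≡ - eval₁ f
eval₁-neg []      = refl
eval₁-neg (a ∷ f) = trans (cong (λ z → - a + z) (eval₁-neg f)) (sym (ℤ.neg-distrib-+ a (eval₁ f)))

deriv₁-neg : ∀ f → deriv₁ (neg f) ≡ - deriv₁ f
deriv₁-neg []      = refl
deriv₁-neg (a ∷ f) =
  trans (cong₂ _+_ (deriv₁-neg f) (eval₁-neg f)) (sym (ℤ.neg-distrib-+ (deriv₁ f) (eval₁ f)))

eval₁-shiftq : ∀ k f → eval₁ (shiftq k f) ≡ eval₁ f
eval₁-shiftq zero    f = refl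
eval₁-shiftq (suc k) f = trans (ℤ.+-identityˡ _) (eval₁-shiftq k f)

deriv₁-shiftq : ∀ k f → deriv₁ (shiftq k f) ≡ deriv₁ f + + k * eval₁ f
deriv₁-shiftq zero    f = sym (ℤ.+-identityʳ _)
deriv₁-shiftq (suc k) f =
  trans (cong₂ _+_ (deriv₁-shiftq k f) (eval₁-shiftq k f)) (p (deriv₁ f) (+ k) (eval₁ f))
  where
  p : ∀ d k e → d + k * e + e ≡ d + (+ 1 + k) * e
  p = solve-∀

eval₁-qint⊗ : ∀ c f → eval₁ (qint c ⊗ f) ≡ + c * eval₁ f
eval₁-qint⊗ zero    f = refl
eval₁-qint⊗ (suc c) f rewrite map-1* f | eval₁-⊕ f (+ 0 ∷ (qint c ⊗ f)) | eval₁-qint⊗ c f =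
  p (+ c) (eval₁ f)
  where
  p : ∀ c e → e + (+ 0 + c * e) ≡ (+ 1 + c) * e
  p = solve-∀

-- The product rule, with c (c - 1) / 2 as the derivative of [c]_q at 1. Doubling stays in ℤ, and is
-- the origin of the factor 2 in `deriv₁-matVec`.
deriv₁-qint⊗ : ∀ c f → + 2 * deriv₁ (qint c ⊗ f) ≡
                       + c * (+ c - + 1) * eval₁ f + + 2 * + c * deriv₁ f
deriv₁-qint⊗ zero    f = refl
deriv₁-qint⊗ (suc c) f rewrite map-1* f | deriv₁-⊕ f (+ 0 ∷ (qint c ⊗ f)) | eval₁-qint⊗ c f =
  trans (p (deriv₁ f) (deriv₁ (qint c ⊗ f)) (+ c * eval₁ f))
    (trans (cong (λ z → + 2 * deriv₁ f + z + + 2 * (+ c * eval₁ f)) (deriv₁-qint⊗ c f))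
           (q (+ c) (eval₁ f) (deriv₁ f)))
  where
  p : ∀ d x y → + 2 * (d + (x + y)) ≡ + 2 * d + + 2 * x + + 2 * y
  p = solve-∀
  q : ∀ c e d → + 2 * d + (c * (c - + 1) * e + + 2 * c * d) + + 2 * (c * e) ≡
                (+ 1 + c) * (+ 1 + c - + 1) * e + + 2 * (+ 1 + c) * d
  q = solve-∀

eval₁-∷ʳ : ∀ f a → eval₁ (f ∷ʳ a) ≡ eval₁ f + a
eval₁-∷ʳ []      a = ℤ.+-comm a (+ 0)
eval₁-∷ʳ (b ∷ f) a = trans (cong (λ z → b + z) (eval₁-∷ʳ f a)) (sym (ℤ.+-assoc b _ a))

deriv₁-∷ʳ : ∀ f a → deriv₁ (f ∷ʳ a) ≡ deriv₁ f + + length f * a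
deriv₁-∷ʳ []      a = refl
deriv₁-∷ʳ (b ∷ f) a =
  trans (cong₂ _+_ (deriv₁-∷ʳ f a) (eval₁-∷ʳ f a)) (p (deriv₁ f) (+ length f) a (eval₁ f))
  where
  p : ∀ d l a e → d + l * a + (e + a) ≡ d + e + (+ 1 + l) * a
  p = solve-∀

-- The old and the new position of each coefficient add up to length f - 1.
deriv₁-reverse : ∀ f → deriv₁ (reverse f) + deriv₁ f ≡ (+ length f - + 1) * eval₁ f
deriv₁-reverse []      = refl
deriv₁-reverse (a ∷ f)
  rewrite List.unfold-reverse a f | deriv₁-∷ʳ (reverse f) a | List.length-reverse f =
  trans (p (deriv₁ (reverse f)) (deriv₁ f) (+ length f * a) (eval₁ f))
    (trans (cong (λ z → z + + length f * a + eval₁ f) (deriv₁-reverse f))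
           (q (+ length f) a (eval₁ f)))
  where
  p : ∀ x y z e → x + z + (y + e) ≡ x + y + z + e
  p = solve-∀
  q : ∀ l a e → (l - + 1) * e + l * a + e ≡ (+ 1 + l - + 1) * (a + e)
  q = solve-∀

eval₁-matVec : ∀ cs → eval₁ (R cs) ≡ num cs × eval₁ (S cs) ≡ den cs
eval₁-matVec []       = refl , refl
eval₁-matVec (c ∷ cs) = first , proj₁ (eval₁-matVec cs)
  where
  T = shiftq (c ℕ.∸ 1) (S cs)
  first : eval₁ (R (c ∷ cs)) ≡ + c * num cs - den cs
  first = begin
    eval₁ ((qint c ⊗ R cs) ⊕ neg T)         ≡⟨ eval₁-⊕ (qint c ⊗ R cs) (neg T) ⟩
    eval₁ (qint c ⊗ R cs) + eval₁ (neg T)   ≡⟨ cong₂ _+_ (eval₁-qint⊗ c (R cs)) (eval₁-neg T) ⟩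
    + c * eval₁ (R cs) - eval₁ T            ≡⟨ cong₂ (λ x y → + c * x - y) (proj₁ (eval₁-matVec cs))
                                                 (trans (eval₁-shiftq (c ℕ.∸ 1) (S cs)) (proj₂ (eval₁-matVec cs))) ⟩
    + c * num cs - den cs                   ∎

-- The second equation, the first one for the tail of the list rewritten in terms of the whole list,
-- is what makes the induction a one-step one.
deriv₁-matVec : ∀ {cs} → Valid cs →
  + 2 * deriv₁ (R cs) ≡ + deg cs * num cs + den cs - num⁻ cs ×
  + 2 * deriv₁ (S cs) ≡ (+ deg cs + + 1) * den cs - num cs - den⁻ cs
deriv₁-matVec []                 = refl , refl
deriv₁-matVec {suc k ∷ cs} (_ ∷ v) = first , second
  where
  n = + deg cs
  s = num cs
  d = den cs
  d′ = num⁻ cs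
  e′ = den⁻ cs
  T = shiftq k (S cs)
  expand : ∀ x d k e → + 2 * (x + - (d + k * e)) ≡ + 2 * x - + 2 * d - + 2 * k * e
  expand = solve-∀
  collect : ∀ n k s d d′ e′ →
    (+ 1 + k) * (+ 1 + k - + 1) * s + (+ 1 + k) * (n * s + d - d′)
      - ((n + + 1) * d - s - e′) - + 2 * k * d ≡
    (k + n) * ((+ 1 + k) * s - d) + s - ((+ 1 + k) * d′ - e′)
  collect = solve-∀
  regroup : ∀ c D → + 2 * c * D ≡ c * (+ 2 * D)
  regroup = solve-∀
  first : + 2 * deriv₁ (R (suc k ∷ cs)) ≡
          (+ k + n) * (+ suc k * s - d) + s - (+ suc k * d′ - e′)
  first = begin
    + 2 * deriv₁ ((qint (suc k) ⊗ R cs) ⊕ neg T)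
      ≡⟨ cong (+ 2 *_) (trans (deriv₁-⊕ (qint (suc k) ⊗ R cs) (neg T))
           (cong (λ z → deriv₁ (qint (suc k) ⊗ R cs) + z)
             (trans (deriv₁-neg T) (cong -_ (deriv₁-shiftq k (S cs)))))) ⟩
    + 2 * (deriv₁ (qint (suc k) ⊗ R cs) + - (deriv₁ (S cs) + + k * eval₁ (S cs)))
      ≡⟨ expand (deriv₁ (qint (suc k) ⊗ R cs)) (deriv₁ (S cs)) (+ k) (eval₁ (S cs)) ⟩
    + 2 * deriv₁ (qint (suc k) ⊗ R cs) - + 2 * deriv₁ (S cs) - + 2 * + k * eval₁ (S cs)
      ≡⟨ cong₂ (λ x y → x - y - + 2 * + k * eval₁ (S cs))
           (trans (deriv₁-qint⊗ (suc k) (R cs))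
             (cong₂ (λ e D → + suc k * (+ suc k - + 1) * e + D) (proj₁ (eval₁-matVec cs))
               (trans (regroup (+ suc k) (deriv₁ (R cs))) (cong (+ suc k *_) (proj₁ (deriv₁-matVec v))))))
           (proj₂ (deriv₁-matVec v)) ⟩
    + suc k * (+ suc k - + 1) * s + + suc k * (n * s + d - d′)
      - ((n + + 1) * d - s - e′) - + 2 * + k * eval₁ (S cs)
      ≡⟨ cong (λ z → + suc k * (+ suc k - + 1) * s + + suc k * (n * s + d - d′)
                       - ((n + + 1) * d - s - e′) - + 2 * + k * z) (proj₂ (eval₁-matVec cs)) ⟩
    + suc k * (+ suc k - + 1) * s + + suc k * (n * s + d - d′)
      - ((n + + 1) * d - s - e′) - + 2 * + k * d
      ≡⟨ collect n (+ k) s d d′ e′ ⟩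
    (+ k + n) * (+ suc k * s - d) + s - (+ suc k * d′ - e′) ∎
  tail : ∀ n k s d d′ → n * s + d - d′ ≡ (k + n + + 1) * s - ((+ 1 + k) * s - d) - d′
  tail = solve-∀
  second : + 2 * deriv₁ (R cs) ≡ (+ k + n + + 1) * s - (+ suc k * s - d) - d′
  second = trans (proj₁ (deriv₁-matVec v)) (tail n (+ k) s d d′)

-- Palindromicity of R and the equality d = d′

palindromic⇒den≡num⁻ : ∀ {cs} → Valid cs → Palindromic (R cs) → den cs ≡ num⁻ cs
palindromic⇒den≡num⁻ {cs} v pal = ℤ.i-j≡0⇒i≡j (den cs) (num⁻ cs) (+-cancelˡ (n * num cs) _ _ (begin
  n * num cs + (den cs - num⁻ cs)    ≡⟨ ℤ.+-assoc (n * num cs) _ _ ⟨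
  n * num cs + den cs - num⁻ cs      ≡⟨ proj₁ (deriv₁-matVec v) ⟨
  + 2 * deriv₁ f                     ≡⟨ double (deriv₁ f) ⟩
  deriv₁ f + deriv₁ f                ≡⟨ cong (λ g → deriv₁ g + deriv₁ f) fixed ⟨
  deriv₁ (reverse f) + deriv₁ f      ≡⟨ deriv₁-reverse f ⟩
  (+ length f - + 1) * eval₁ f       ≡⟨ cong₂ (λ l e → (+ l - + 1) * e) (monic-length m) (proj₁ (eval₁-matVec cs)) ⟩
  (+ suc (deg cs) - + 1) * num cs    ≡⟨ simplify n (num cs) ⟩
  n * num cs + + 0                   ∎))
  where
  f = R cs
  n = + deg cs
  m = proj₁ (monic-R v)
  fixed : reverse f ≡ f
  fixed = subst (λ g → reverse g ≡ g) (strip-monic m) pal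
  double : ∀ x → + 2 * x ≡ x + x
  double = solve-∀
  simplify : ∀ n s → (+ 1 + n - + 1) * s ≡ n * s + + 0
  simplify = solve-∀

den≡num⁻⇒palindromic : ∀ {cs} → Valid cs → den cs ≡ num⁻ cs → Palindromic (R cs)
den≡num⁻⇒palindromic {cs} v d≡d′ =
  subst (λ g → reverse g ≡ g) (sym (strip-monic m))
    (coeff-injective (List.length-reverse f) same)
  where
  f = R cs
  m = proj₁ (monic-R v)
  reverse-cs : reverse cs ≡ cs
  reverse-cs = val-injective (reverse-valid v) v
    (trans (proj₁ (val-reverse cs)) (cong (num cs ,_) (sym d≡d′)))
  same : ∀ i → coeff (reverse f) i ≡ coeff f i
  same i = begin
    coeff (reverse f) i       ≡⟨ mirror-list f j i j+i ⟨
    coeff f j                 ≡⟨ proj₁ (coeff-matVec cs) j ⟩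
    numq cs j                 ≡⟨ proj₁ (mirror-reverse v) j i (trans j+i (cong (λ l → + l - + 1) (monic-length m))) ⟩
    numq (reverse cs) i       ≡⟨ cong (λ ds → numq ds i) reverse-cs ⟩
    numq cs i                 ≡⟨ proj₁ (coeff-matVec cs) i ⟨
    coeff f i                 ∎
    where
    j = + length f - + 1 - i
    p : ∀ i l → l - + 1 - i + i ≡ l - + 1
    p = solve-∀
    j+i : j + i ≡ + length f - + 1
    j+i = p i (+ length f)

-- The continued fraction algorithm

-- The values are recorded for the tail, since S of `c₁ ∷ cs` is by definition R of `cs`; r enters
-- only through d = c₁ s - r.
record Expansion (r s : ℕ) (cfs : List ℕ) : Set where
  constructor expansion
  field
    {c₁}  : ℕ
    {cs}  : List ℕ
    cfs≡  : cfs ≡ c₁ ∷ cs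
    2≤c₁  : 2 ℕ.≤ c₁
    valid : Valid cs
    num≡  : num cs ≡ + s
    den≡  : den cs ≡ + c₁ * + s - + r

-- Together these say 0 ≤ c s - r < s. The first makes the truncated subtraction in `negCF` exact,
-- the second makes the denominators decrease.
ceiling-bounds : ∀ r s′ → let c = (r ℕ.+ s′) ℕ./ suc s′ in
                 r ℕ.≤ c ℕ.* suc s′ × c ℕ.* suc s′ ℕ.≤ r ℕ.+ s′
ceiling-bounds r s′ = ℕ.+-cancelˡ-≤ s′ r (c ℕ.* suc s′) lower , ℕ.m/n*n≤m (r ℕ.+ s′) (suc s′)
  where
  c = (r ℕ.+ s′) ℕ./ suc s′
  lower : s′ ℕ.+ r ℕ.≤ s′ ℕ.+ c ℕ.* suc s′
  lower = subst (ℕ._≤ s′ ℕ.+ c ℕ.* suc s′)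
    (trans (sym (ℕ.m≡m%n+[m/n]*n (r ℕ.+ s′) (suc s′))) (ℕ.+-comm r s′))
    (ℕ.+-monoˡ-≤ (c ℕ.* suc s′) (ℕ.m<1+n⇒m≤n (ℕ.m%n<n (r ℕ.+ s′) (suc s′))))

remainder : ∀ c s {r d} → d ℕ.+ r ≡ c ℕ.* s → + d ≡ + c * + s - + r
remainder c s {r} {d} eq = begin
  + d                  ≡⟨ p (+ d) (+ r) ⟩
  + (d ℕ.+ r) - + r    ≡⟨ cong (λ z → + z - + r) eq ⟩
  + (c ℕ.* s) - + r    ≡⟨ cong (_- + r) (ℤ.pos-* c s) ⟩
  + c * + s - + r      ∎
  where
  p : ∀ d r → d ≡ d + r - r
  p = solve-∀

negCF-expansion : ∀ fuel {r s} → 0 ℕ.< s → s ℕ.< r → s ℕ.≤ fuel → Coprime r s →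
                  Expansion r s (negCF (suc fuel) r s)
negCF-expansion zero       {s = suc s′} _ _ ()
negCF-expansion (suc fuel) {r} {s = suc s′} _ s<r (s≤s s′≤fuel) cop
  with (r ℕ.+ s′) ℕ./ suc s′ | ceiling-bounds r s′
... | c | r≤cs , cs≤r+s′ with c ℕ.* suc s′ ℕ.∸ r in eq
... | d = result d d+r≡cs d≤s′
  where
  s = suc s′
  d+r≡cs : d ℕ.+ r ≡ c ℕ.* s
  d+r≡cs = trans (cong (ℕ._+ r) (sym eq)) (ℕ.m∸n+n≡m r≤cs)
  d≤s′ : d ℕ.≤ s′
  d≤s′ = ℕ.+-cancelʳ-≤ r d s′
    (ℕ.≤-trans (ℕ.≤-reflexive d+r≡cs) (ℕ.≤-trans cs≤r+s′ (ℕ.≤-reflexive (ℕ.+-comm r s′))))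
  2≤c : 2 ℕ.≤ c
  2≤c = ℕ.*-cancelʳ-< s 1 c (subst (ℕ._< c ℕ.* s) (sym (ℕ.*-identityˡ s)) (ℕ.<-≤-trans s<r r≤cs))
  result : ∀ d → d ℕ.+ r ≡ c ℕ.* s → d ℕ.≤ s′ → Expansion r s
           (if does (d ℕ.≟ 0) then c ∷ [] else c ∷ negCF (suc fuel) s d)
  -- The algorithm stops when s divides r. Coprimality then forces s = 1, the numerator of the empty
  -- tail.
  result zero    r≡cs _ = expansion refl 2≤c [] (cong +_ (sym s≡1)) (remainder c s r≡cs)
    where
    s≡1 : s ≡ 1
    s≡1 = cop (ℕ.divides c r≡cs , ℕ.∣-refl)
  result (suc d) d+r≡cs d<s′ with negCF-expansion fuel (s≤s z≤n) (s≤s d<s′) (ℕ.≤-trans d<s′ s′≤fuel) cop′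
    where
    cop′ : Coprime s (suc d)
    cop′ {i} (i∣s , i∣d) = cop (ℕ.∣m+n∣m⇒∣n (subst (i ℕ.∣_) (sym d+r≡cs) (ℕ.∣n⇒∣m*n c i∣s)) i∣d , i∣s)
  ... | expansion {c₂} {cs} cfs≡ 2≤c₂ v num≡ den≡ =
    expansion (cong (c ∷_) cfs≡) 2≤c (2≤c₂ ∷ v)
      (trans (cong₂ (λ x y → + c₂ * x - y) num≡ den≡) (p (+ c₂ * + suc d) (+ s)))
      (trans num≡ (remainder c s d+r≡cs))
    where
    p : ∀ x y → x - (x - y) ≡ y
    p = solve-∀

-- The equality d = d′ as a congruence modulo s

residue-unique : ∀ {s x y} → + 0 ≤ x → x < + s → + 0 ≤ y → y < + s → + s Signed.∣ (x - y) → x ≡ y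
residue-unique {s} {+ x} {+ y} _ (ℤ.+<+ x<s) _ (ℤ.+<+ y<s) s∣x-y with + x - + y ℤ.≟ + 0
... | yes eq = ℤ.i-j≡0⇒i≡j (+ x) (+ y) eq
... | no  ne = contradiction (ℕ.∣⇒≤ {{ℤ.≢-nonZero ne}} (Signed.∣⇒∣ᵤ s∣x-y)) (ℕ.<⇒≱ small)
  where
  small : ∣ + x - + y ∣ ℕ.< s
  small = ℕ.≤-<-trans (subst (λ z → ∣ z ∣ ℕ.≤ x ℕ.⊔ y) (sym (ℤ.m-n≡m⊖n x y)) (ℤ.∣m⊝n∣≤m⊔n x y))
                      (ℕ.⊔-lub x<s y<s)

module _ {r s : ℕ} {cfs : List ℕ} (e : Expansion r s cfs) where
  open Expansion e

  private
    d d′ e′ : ℤ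
    d  = den cs
    d′ = num⁻ cs
    e′ = den⁻ cs

    -- d′ is an inverse of d ≡ − r modulo s.
    det-s : + s * e′ ≡ d * d′ - + 1
    det-s = subst (λ z → z * e′ ≡ d * d′ - + 1) num≡ (det cs)

  den≡num⁻⇒∣ : d ≡ d′ → + s Signed.∣ (+ r * + r - + 1)
  den≡num⁻⇒∣ d≡d′ = Signed.divides (+ c₁ * + c₁ * + s - + 2 * + c₁ * d + e′) (begin
    + r * + r - + 1
      ≡⟨ cong (λ z → z * z - + 1) r≡ ⟩
    (+ c₁ * + s - d) * (+ c₁ * + s - d) - + 1
      ≡⟨ p (+ c₁) (+ s) d ⟩
    (+ c₁ * + c₁ * + s - + 2 * + c₁ * d) * + s + (d * d - + 1)
      ≡⟨ cong (λ z → (+ c₁ * + c₁ * + s - + 2 * + c₁ * d) * + s + (d * z - + 1)) d≡d′ ⟩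
    (+ c₁ * + c₁ * + s - + 2 * + c₁ * d) * + s + (d * d′ - + 1)
      ≡⟨ cong (λ z → (+ c₁ * + c₁ * + s - + 2 * + c₁ * d) * + s + z) det-s ⟨
    (+ c₁ * + c₁ * + s - + 2 * + c₁ * d) * + s + + s * e′
      ≡⟨ q (+ c₁ * + c₁ * + s - + 2 * + c₁ * d) (+ s) e′ ⟩
    (+ c₁ * + c₁ * + s - + 2 * + c₁ * d + e′) * + s ∎)
    where
    r≡ : + r ≡ + c₁ * + s - d
    r≡ = trans (u (+ c₁ * + s) (+ r)) (cong (λ z → + c₁ * + s - z) (sym den≡))
      where
      u : ∀ x r → r ≡ x - (x - r)
      u = solve-∀
    p : ∀ c s d → (c * s - d) * (c * s - d) - + 1 ≡ (c * c * s - + 2 * c * d) * s + (d * d - + 1)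
    p = solve-∀
    q : ∀ x s e → x * s + s * e ≡ (x + e) * s
    q = solve-∀

  -- d² ≡ 1 gives d ≡ d (d d′) = d² d′ ≡ d′.
  ∣⇒den≡num⁻ : + s Signed.∣ (+ r * + r - + 1) → d ≡ d′
  ∣⇒den≡num⁻ (Signed.divides k r²-1≡ks) =
    residue-unique (proj₁ d-bounds) (below (proj₂ d-bounds)) (proj₁ d′-bounds) (below (proj₂ d′-bounds))
      (Signed.divides (m * d′ - d * e′) (begin
        d - d′
          ≡⟨ p d d′ ⟩
        (d * d - + 1) * d′ - d * (d * d′ - + 1)
          ≡⟨ cong₂ (λ x y → x * d′ - d * y) d²-1≡ms (sym det-s) ⟩
        m * + s * d′ - d * (+ s * e′)
          ≡⟨ q m (+ s) d d′ e′ ⟩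
        (m * d′ - d * e′) * + s ∎))
    where
    m = + c₁ * + c₁ * + s - + 2 * + c₁ * + r + k
    p : ∀ d d′ → d - d′ ≡ (d * d - + 1) * d′ - d * (d * d′ - + 1)
    p = solve-∀
    q : ∀ m s d d′ e′ → m * s * d′ - d * (s * e′) ≡ (m * d′ - d * e′) * s
    q = solve-∀
    u : ∀ c s r → (c * s - r) * (c * s - r) - + 1 ≡ (c * c * s - + 2 * c * r) * s + (r * r - + 1)
    u = solve-∀
    d²-1≡ms : d * d - + 1 ≡ m * + s
    d²-1≡ms = begin
      d * d - + 1
        ≡⟨ cong (λ z → z * z - + 1) den≡ ⟩
      (+ c₁ * + s - + r) * (+ c₁ * + s - + r) - + 1
        ≡⟨ u (+ c₁) (+ s) (+ r) ⟩
      (+ c₁ * + c₁ * + s - + 2 * + c₁ * + r) * + s + (+ r * + r - + 1)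
        ≡⟨ cong (λ z → (+ c₁ * + c₁ * + s - + 2 * + c₁ * + r) * + s + z) r²-1≡ks ⟩
      (+ c₁ * + c₁ * + s - + 2 * + c₁ * + r) * + s + k * + s
        ≡⟨ ℤ.*-distribʳ-+ (+ s) (+ c₁ * + c₁ * + s - + 2 * + c₁ * + r) k ⟨
      m * + s ∎
    d-bounds : + 0 ≤ d × d < num cs
    d-bounds = 0≤den<num valid
    -- d′ is the denominator of the reversed list, so the bound on denominators applies to it.
    d′-bounds : + 0 ≤ d′ × d′ < num cs
    d′-bounds = subst (λ { (x , y) → + 0 ≤ y × y < x }) (proj₁ (val-reverse cs))
                      (0≤den<num (reverse-valid valid))
    below : ∀ {x} → x < num cs → x < + s
    below {x} = subst (x <_) num≡

  palindromic⇔ : Palindromic (proj₂ (matVec cfs)) ⇔ (+ s Signed.∣ (+ r * + r - + 1))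
  palindromic⇔ = subst (λ ds → Palindromic (proj₂ (matVec ds)) ⇔ (+ s Signed.∣ (+ r * + r - + 1))) (sym cfs≡)
    (mk⇔ (λ pal → den≡num⁻⇒∣ (palindromic⇒den≡num⁻ valid pal))
         (λ div → den≡num⁻⇒palindromic valid (∣⇒den≡num⁻ div)))

-- Reduction to r > s

-- The hypothesis says that `fuel` additions of s carry r beyond s; `Sgo` gets one unit more for the
-- last comparison, so its default value `[]` is never reached.
Sgo-reduce : ∀ fuel r s → + s < r + + fuel * + s →
  ∃ λ r′ → s ℕ.< r′ × Sgo (suc fuel) r s ≡ S>1 r′ s × + s Signed.∣ (+ r′ - r)
Sgo-reduce fuel r s enough with + s ℤ.<? r
Sgo-reduce fuel (+ r) s enough | yes (ℤ.+<+ s<r) =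
  r , s<r , refl , Signed.divides (+ 0) (ℤ.+-inverseʳ (+ r))
Sgo-reduce zero r s enough | no s≮r = contradiction (subst (+ s <_) (ℤ.+-identityʳ r) enough) s≮r
Sgo-reduce (suc fuel) r s enough | no s≮r
  with Sgo-reduce fuel (r + + s) s (subst (+ s <_) (p r (+ fuel) (+ s)) enough)
  where
  p : ∀ r f s → r + (+ 1 + f) * s ≡ r + s + f * s
  p = solve-∀
... | r′ , s<r′ , eq , Signed.divides k r′-r≡ks = r′ , s<r′ , eq , Signed.divides (k + + 1)
  (trans (p (+ r′) r (+ s)) (trans (cong (λ z → z + + s) r′-r≡ks) (q k (+ s))))
  where
  p : ∀ r′ r s → r′ - r ≡ r′ - (r + s) + s
  p = solve-∀
  q : ∀ k s → k * s + s ≡ (k + + 1) * s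
  q = solve-∀

-- As s ≥ 1, r + ∣r∣ s ≥ 0. Two further copies of s make the inequality strict.
fuel-suffices : ∀ r s → 0 ℕ.< s → + s < r + + (∣ r ∣ ℕ.+ 2) * + s
fuel-suffices r (suc s′) _ = ℤ.<-≤-trans s<2s (ℤ.≤-trans (ℤ.≤-reflexive (sym (ℤ.+-identityˡ (+ 2 * s)))) (ℤ.≤-trans
    (ℤ.+-monoˡ-≤ (+ 2 * s) (0≤r+∣r∣s r))
    (ℤ.≤-reflexive (p r (+ ∣ r ∣) s))))
  where
  s = + suc s′
  s<2s : s < + 2 * s
  s<2s = subst (_< + 2 * s) (ℤ.*-identityˡ s) (ℤ.*-monoʳ-<-pos s (ℤ.+<+ {1} {2} (s≤s (s≤s z≤n))))
  p : ∀ r a s → r + a * s + + 2 * s ≡ r + (a + + 2) * s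
  p = solve-∀
  0≤r+∣r∣s : ∀ r → + 0 ≤ r + + ∣ r ∣ * s
  0≤r+∣r∣s (+ n)    = ℤ.+-mono-≤ (ℤ.+≤+ {0} {n} z≤n)
    (subst (+ 0 ≤_) (ℤ.pos-* n (suc s′)) (ℤ.+≤+ {0} {n ℕ.* suc s′} z≤n))
  0≤r+∣r∣s -[1+ n ] = subst (+ 0 ≤_) (ℤ.+-comm (+ suc n * s) -[1+ n ])
    (ℤ.i≤j⇒0≤j-i (subst (_≤ + suc n * s) (ℤ.*-identityʳ (+ suc n))
      (ℤ.*-monoˡ-≤-nonNeg (+ suc n) (ℤ.+≤+ {1} {suc s′} (s≤s z≤n)))))

coprime-translate : ∀ {r r′ s} → + s Signed.∣ (r′ - r) → Coprime ∣ r ∣ s → Coprime ∣ r′ ∣ s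
coprime-translate {r} {r′} {s} div cop {i} (i∣r′ , i∣s) = cop (Signed.∣⇒∣ᵤ {+ i} {r} i∣r , i∣s)
  where
  i∣r′ˢ : + i Signed.∣ r′
  i∣r′ˢ = Signed.∣ᵤ⇒∣ i∣r′
  p : ∀ r′ r → r′ - (r′ - r) ≡ r
  p = solve-∀
  i∣r : + i Signed.∣ r
  i∣r = subst (+ i Signed.∣_) (p r′ r)
    (Signed.∣m∣n⇒∣m-n i∣r′ˢ (Signed.∣-trans (Signed.∣ᵤ⇒∣ {+ i} {+ s} i∣s) div))

square-translate : ∀ {r r′ s} → s Signed.∣ (r′ - r) → s Signed.∣ (r * r - + 1) → s Signed.∣ (r′ * r′ - + 1)
square-translate {r} {r′} {s} div div² = subst (s Signed.∣_) (p r r′)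
  (Signed.∣m∣n⇒∣m+n (Signed.∣m⇒∣m*n (r′ + r) div) div²)
  where
  p : ∀ r r′ → (r′ - r) * (r′ + r) + (r * r - + 1) ≡ r′ * r′ - + 1
  p = solve-∀

theorem3p6 : (r : ℤ) (s : ℕ) → s > 0 → Coprime ∣ r ∣ s →
    (Palindromic (Sq r s) ⇔ (+ s ∣ (r * r - + 1)))
theorem3p6 r s s>0 cop
  with Sgo-reduce (∣ r ∣ ℕ.+ 2) r s (fuel-suffices r s s>0)
... | r′ , s<r′ , Sgo≡ , div = mk⇔
  (λ pal → Signed.∣⇒∣ᵤ (square-translate {+ r′} {r} div⁻ (to (subst Palindromic Sq≡ pal))))
  (λ d → subst Palindromic (sym Sq≡) (from (square-translate {r} {+ r′} div (Signed.∣ᵤ⇒∣ d))))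
  where
  open Equivalence (palindromic⇔ (negCF-expansion s s>0 s<r′ ℕ.≤-refl (coprime-translate {r} {+ r′} div cop)))
  Sq≡ : Sq r s ≡ S>1 r′ s
  Sq≡ = trans (cong (λ f → Sgo f r s) (ℕ.+-suc ∣ r ∣ 2)) Sgo≡
  p : ∀ x y → - (x - y) ≡ y - x
  p = solve-∀
  div⁻ : + s Signed.∣ (r - + r′)
  div⁻ = subst (+ s Signed.∣_) (p (+ r′) r) (Signed.∣m⇒∣-m div)
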